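{- Let $(M,\in)$ be a countable model of ZFA. Then the membership graph of $M$, keeping double edges, is not $\aleph_0$-categorical. That is, let $\mathcal{G}$ be the first-order structure with domain $M$ and two symmetric binary relations $E$ and $D$, where $E(x,y)$ holds if and only if $M\models x\in y$ or $M\models y\in x$, and $D(x,y)$ holds if and only if $M\models x\in y$ and $M\models y\in x$. Then the complete first-order theory of $\mathcal{G}$ is not $\aleph_0$-categorical.
   Context: ZFA denotes the first-order theory obtained from ZFC (all objects being sets) by deleting the Axiom of Foundation and replacing it by the Anti-Foundation Axiom AFA. AFA states that every flat system of equations has a unique solution. A flat system of equations consists of a set $X$ of indeterminates, a set $A$ of sets called atoms (disjoint from $X$), and, for each $x\in X$, an equation $x=S_x$ with $S_x\subseteq X\cup A$ (the family $(S_x)_{x\in X}$ being itself a set). A solution is an assignment of sets to the indeterminates making all equations true, i.e. a function $s$ with domain $X$ such that $s(x)=\{s(y):y\in S_x\cap X\}\cup(S_x\cap A)$ for all $x\in X$. The membership graph of $M$, keeping double edges, is the undirected multigraph with vertex set $M$ in which distinct $x,y$ are joined by a double edge if both $x\in y$ and $y\in x$, by a single edge if exactly one of $x\in y$, $y\in x$ holds, and by no edge otherwise; $x$ has a loop if $x\in x$. A countable first-order structure is $\aleph_0$-categorical if it is determined up to isomorphism by its first-order theory and the property of countability, i.e. every countable model of its complete first-order theory is isomorphic to it. -}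

module Defs where

open import Data.Empty using (⊥)
open import Data.Fin.Base using (Fin; zero; suc; opposite; punchIn)
open import Data.Fin using (#_)
open import Data.Fin.Patterns using (0F; 1F; 2F)
open import Data.Nat.Base using (ℕ; zero; suc; _+_)
open import Data.Nat.Properties using (_<?_)
open import Data.Product.Base using (Σ-syntax; _×_)
open import Data.Sum.Base using (_⊎_)
open import Data.Unit.Base using (tt)
open import Data.Vec.Base using (Vec; []; _∷_; lookup; map)
open import Function.Bundles using (_⇔_; _↣_; _⤖_; module Bijection)
open import Level using (0ℓ)
open import Relation.Binary.PropositionalEquality.Core using (_≡_)
open import Relation.Nullary.Decidable.Core using (True)
open import Relation.Unary using (Pred; _∈_)

record Language : Set₁ where
  field
    Rel   : Set
    arity : Rel → ℕ

open Language public

infix  8 _≐_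
infixr 7 _∧′_
infixr 6 _∨′_
infixr 5 _⇒′_
infix  4 _⇔′_

-- Variables are de Bruijn indices: a Formula 𝓛 n has its free variables
-- among 0, …, n - 1, and a quantifier binds index 0.

data Formula (𝓛 : Language) (n : ℕ) : Set where
  rel  : (R : Rel 𝓛) → Vec (Fin n) (arity 𝓛 R) → Formula 𝓛 n
  _≐_  : Fin n → Fin n → Formula 𝓛 n
  ⊥′   : Formula 𝓛 n
  _∧′_ : Formula 𝓛 n → Formula 𝓛 n → Formula 𝓛 n
  _∨′_ : Formula 𝓛 n → Formula 𝓛 n → Formula 𝓛 n
  _⇒′_ : Formula 𝓛 n → Formula 𝓛 n → Formula 𝓛 n
  ∀′   : Formula 𝓛 (suc n) → Formula 𝓛 n
  ∃′   : Formula 𝓛 (suc n) → Formula 𝓛 n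

Sentence : Language → Set
Sentence 𝓛 = Formula 𝓛 0

Theory : Language → Set₁
Theory 𝓛 = Pred (Sentence 𝓛) 0ℓ

private
  variable
    𝓛   : Language
    m n : ℕ

¬′_ : Formula 𝓛 n → Formula 𝓛 n
¬′ φ = φ ⇒′ ⊥′

_⇔′_ : Formula 𝓛 n → Formula 𝓛 n → Formula 𝓛 n
φ ⇔′ ψ = (φ ⇒′ ψ) ∧′ (ψ ⇒′ φ)

ext : (Fin m → Fin n) → Fin (suc m) → Fin (suc n)
ext f zero    = zero
ext f (suc i) = suc (f i)

rename : (Fin m → Fin n) → Formula 𝓛 m → Formula 𝓛 n
rename f (rel R xs) = rel R (map f xs)
rename f (x ≐ y)    = f x ≐ f y
rename f ⊥′         = ⊥′
rename f (φ ∧′ ψ)   = rename f φ ∧′ rename f ψ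
rename f (φ ∨′ ψ)   = rename f φ ∨′ rename f ψ
rename f (φ ⇒′ ψ)   = rename f φ ⇒′ rename f ψ
rename f (∀′ φ)     = ∀′ (rename (ext f) φ)
rename f (∃′ φ)     = ∃′ (rename (ext f) φ)

-- skip i φ makes room for a new variable with index i, not free in
-- the result.

skip : Fin (suc n) → Formula 𝓛 n → Formula 𝓛 (suc n)
skip i = rename (punchIn i)

∃!′ : Formula 𝓛 (suc n) → Formula 𝓛 n
∃!′ φ = ∃′ (φ ∧′ ∀′ (skip 1F φ ⇒′ 0F ≐ 1F))

∀* : ∀ {n} → Formula 𝓛 n → Sentence 𝓛
∀* {n = zero}  φ = φ
∀* {n = suc _} φ = ∀* (∀′ φ)

record Structure (𝓛 : Language) : Set₁ where
  field
    Carrier : Set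
    interp  : (R : Rel 𝓛) → Vec Carrier (arity 𝓛 R) → Set

open Structure public

-- Tarski's definition of truth; the i-th entry of ρ is the value of
-- variable i.

_,_⊨′_ : (𝔄 : Structure 𝓛) → ∀ {n} → Vec (Carrier 𝔄) n → Formula 𝓛 n → Set
𝔄 , ρ ⊨′ rel R xs = interp 𝔄 R (map (lookup ρ) xs)
𝔄 , ρ ⊨′ (x ≐ y)  = lookup ρ x ≡ lookup ρ y
𝔄 , ρ ⊨′ ⊥′       = ⊥
𝔄 , ρ ⊨′ (φ ∧′ ψ) = (𝔄 , ρ ⊨′ φ) × (𝔄 , ρ ⊨′ ψ)
𝔄 , ρ ⊨′ (φ ∨′ ψ) = (𝔄 , ρ ⊨′ φ) ⊎ (𝔄 , ρ ⊨′ ψ)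
𝔄 , ρ ⊨′ (φ ⇒′ ψ) = 𝔄 , ρ ⊨′ φ → 𝔄 , ρ ⊨′ ψ
𝔄 , ρ ⊨′ ∀′ φ     = (a : Carrier 𝔄) → 𝔄 , (a ∷ ρ) ⊨′ φ
𝔄 , ρ ⊨′ ∃′ φ     = Σ[ a ∈ Carrier 𝔄 ] 𝔄 , (a ∷ ρ) ⊨′ φ

infix 4 _⊨_ _⊨ᵗ_ _≅_

_⊨_ : Structure 𝓛 → Sentence 𝓛 → Set
𝔄 ⊨ φ = 𝔄 , [] ⊨′ φ

_⊨ᵗ_ : Structure 𝓛 → Theory 𝓛 → Set
𝔄 ⊨ᵗ T = ∀ φ → φ ∈ T → 𝔄 ⊨ φ

Th : Structure 𝓛 → Theory 𝓛
Th 𝔄 φ = 𝔄 ⊨ φ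

record _≅_ (𝔄 𝔅 : Structure 𝓛) : Set where
  field
    bijection : Carrier 𝔄 ⤖ Carrier 𝔅
  open Bijection bijection public using (to)
  field
    preserves : ∀ R xs → interp 𝔄 R xs ⇔ interp 𝔅 R (map to xs)

Countable : Structure 𝓛 → Set
Countable 𝔄 = Carrier 𝔄 ↣ ℕ

ℵ₀-Categorical : Structure 𝓛 → Set₁
ℵ₀-Categorical 𝔄 = ∀ 𝔅 → Countable 𝔅 → 𝔅 ⊨ᵗ Th 𝔄 → 𝔅 ≅ 𝔄

data SetRel : Set where
  mem : SetRel

𝓛-set : Language
𝓛-set = record { Rel = SetRel ; arity = λ { mem → 2 } }

infix 8 _∈′_

_∈′_ : ∀ {n} → Fin n → Fin n → Formula 𝓛-set n
x ∈′ y = rel mem (x ∷ y ∷ [])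

∀∈ ∃∈ : Fin n → Formula 𝓛-set (suc n) → Formula 𝓛-set n
∀∈ a φ = ∀′ (0F ∈′ suc a ⇒′ φ)
∃∈ a φ = ∃′ (0F ∈′ suc a ∧′ φ)

Empty : Fin n → Formula 𝓛-set n
Empty a = ∀′ (¬′ (0F ∈′ suc a))

Disjoint : Fin n → Fin n → Formula 𝓛-set n
Disjoint a b = ∀∈ a (¬′ (0F ∈′ suc b))

_⊆′_ : Fin n → Fin n → Formula 𝓛-set n
a ⊆′ b = ∀∈ a (0F ∈′ suc b)

-- b = a ∪ {a}
_IsSuccessorOf_ : Fin n → Fin n → Formula 𝓛-set n
b IsSuccessorOf a = ∀′ (0F ∈′ suc b ⇔′ 0F ∈′ suc a ∨′ 0F ≐ suc a)

-- c = {a , b}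
_≐｛_,_｝ : Fin n → Fin n → Fin n → Formula 𝓛-set n
c ≐｛ a , b ｝ = ∀′ (0F ∈′ suc c ⇔′ 0F ≐ suc a ∨′ 0F ≐ suc b)

-- p is Kuratowski's pair {{a} , {a , b}}
_≐⟨_,_⟩ : Fin n → Fin n → Fin n → Formula 𝓛-set n
p ≐⟨ a , b ⟩ =
  ∀′ (0F ∈′ suc p ⇔′ 0F ≐｛ suc a , suc a ｝ ∨′ 0F ≐｛ suc a , suc b ｝)

⟨_,_⟩∈_ : Fin n → Fin n → Fin n → Formula 𝓛-set n
⟨ a , b ⟩∈ f = ∃∈ f (0F ≐⟨ suc a , suc b ⟩)

-- f is a function with domain d: every p ∈ f is ⟨x , y⟩ for some x ∈ d
-- and some y, and every x ∈ d has a unique y with ⟨x , y⟩ ∈ f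
_IsFunctionOn_ : Fin n → Fin n → Formula 𝓛-set n
f IsFunctionOn d =
     ∀∈ f (∃∈ (suc d) (∃′ (2F ≐⟨ 1F , 0F ⟩)))
  ∧′ ∀∈ d (∃!′ (⟨ 1F , 0F ⟩∈ suc (suc f)))

-- In ∀[ x ] φ the name x : Var k stands for the variable bound under k
-- other binders.  At a use under m binders, k and m being numerals, it
-- becomes the de Bruijn index m - 1 - k.

Var : ℕ → Set
Var k = ∀ {m} → {{True (k <? m)}} → Fin m

var : ∀ k → Var k
var k {{k<m}} = opposite (#_ k {m<n = k<m})

all ex ex! : ∀ {k} → (Var k → Formula 𝓛 (suc k)) → Formula 𝓛 k
all φ = ∀′ (φ (var _))
ex  φ = ∃′ (φ (var _))
ex! φ = ∃!′ (φ (var _))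

all∈ ex∈ : ∀ {k} → Fin k → (Var k → Formula 𝓛-set (suc k)) → Formula 𝓛-set k
all∈ a φ = ∀∈ a (φ (var _))
ex∈  a φ = ∃∈ a (φ (var _))

infix 3 all ex ex! all∈ ex∈
syntax all (λ x → φ)    = ∀[ x ] φ
syntax ex  (λ x → φ)    = ∃[ x ] φ
syntax ex! (λ x → φ)    = ∃![ x ] φ
syntax all∈ a (λ x → φ) = ∀[ x ∈ a ] φ
syntax ex∈  a (λ x → φ) = ∃[ x ∈ a ] φ

Extensionality : Sentence 𝓛-set
Extensionality = ∀[ a ] ∀[ b ] ((∀[ z ] (z ∈′ a ⇔′ z ∈′ b)) ⇒′ a ≐ b)

Pairing : Sentence 𝓛-set
Pairing = ∀[ a ] ∀[ b ] ∃[ c ] c ≐｛ a , b ｝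

Union : Sentence 𝓛-set
Union = ∀[ f ] ∃[ u ] ∀[ z ] (z ∈′ u ⇔′ (∃[ y ∈ f ] z ∈′ y))

PowerSet : Sentence 𝓛-set
PowerSet = ∀[ a ] ∃[ p ] ∀[ z ] (z ∈′ p ⇔′ z ⊆′ a)

Infinity : Sentence 𝓛-set
Infinity = ∃[ i ] ((∃[ e ∈ i ] Empty e) ∧′ (∀[ x ∈ i ] ∃[ y ∈ i ] y IsSuccessorOf x))

-- φ(x, a, parameters), with x = 0 and a = 1:
-- for all a there is b = {x ∈ a : φ(x, a, parameters)}.

Separation : ∀ {n} → Formula 𝓛-set (2 + n) → Sentence 𝓛-set
Separation φ = ∀* (∀′ (∃′ (∀′ (0F ∈′ 1F ⇔′ 0F ∈′ 2F ∧′ skip 1F φ))))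

-- φ(y, x, a, parameters), with y = 0, x = 1 and a = 2:
-- for all a, if every x ∈ a has a unique y with φ(y, x, a, parameters),
-- then there is b such that every x ∈ a has such a y in b.

Replacement : ∀ {n} → Formula 𝓛-set (3 + n) → Sentence 𝓛-set
Replacement φ =
  ∀* (∀′ (∀∈ 0F (∃!′ φ) ⇒′ ∃′ (∀∈ 1F (∃∈ 1F (skip 2F φ)))))

-- Every set of nonempty, pairwise disjoint sets has a transversal.

Choice : Sentence 𝓛-set
Choice = ∀[ f ]
  (    (∀[ x ∈ f ] ¬′ Empty x)
    ∧′ (∀[ x ∈ f ] ∀[ y ∈ f ] (¬′ (x ≐ y) ⇒′ Disjoint x y))
  ⇒′ (∃[ c ] ∀[ x ∈ f ] ∃![ z ] (z ∈′ x ∧′ z ∈′ c)))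

-- X is the set of indeterminates, A the set of atoms, and S the
-- function x ↦ Sₓ on X.

FlatSystem : (X : Var 0) (A : Var 1) (S : Var 2) → Formula 𝓛-set 3
FlatSystem X A S =
     Disjoint X A
  ∧′ S IsFunctionOn X
  ∧′ (∀[ x ∈ X ] ∀[ t ] (⟨ x , t ⟩∈ S ⇒′ (∀[ z ∈ t ] (z ∈′ X ∨′ z ∈′ A))))

-- s is a function on X with s(x) = {s(y) : y ∈ Sₓ ∩ X} ∪ (Sₓ ∩ A);
-- below, t = Sₓ and v = s(x).

Solution : (X : Var 0) (A : Var 1) (S : Var 2) (s : Var 3) → Formula 𝓛-set 4
Solution X A S s =
     s IsFunctionOn X
  ∧′ (∀[ x ∈ X ] ∀[ t ] ∀[ v ]
       (⟨ x , t ⟩∈ S ∧′ ⟨ x , v ⟩∈ s ⇒′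
       (∀[ z ] (z ∈′ v ⇔′
            (∃[ y ] (y ∈′ t ∧′ y ∈′ X ∧′ ⟨ y , z ⟩∈ s))
         ∨′ (z ∈′ t ∧′ z ∈′ A)))))

AntiFoundation : Sentence 𝓛-set
AntiFoundation =
  ∀[ X ] ∀[ A ] ∀[ S ] (FlatSystem X A S ⇒′ (∃![ s ] Solution X A S s))

data ZFA : Theory 𝓛-set where
  extensionality : ZFA Extensionality
  pairing        : ZFA Pairing
  union          : ZFA Union
  powerSet       : ZFA PowerSet
  infinity       : ZFA Infinity
  separation     : ∀ {n} (φ : Formula 𝓛-set (2 + n)) → ZFA (Separation φ)
  replacement    : ∀ {n} (φ : Formula 𝓛-set (3 + n)) → ZFA (Replacement φ)
  choice         : ZFA Choice
  antiFoundation : ZFA AntiFoundation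

data GraphRel : Set where
  E D : GraphRel

𝓛-graph : Language
𝓛-graph = record { Rel = GraphRel ; arity = λ { E → 2 ; D → 2 } }

module _ (𝔐 : Structure 𝓛-set) where

  _∈ᴹ_ : Carrier 𝔐 → Carrier 𝔐 → Set
  x ∈ᴹ y = interp 𝔐 mem (x ∷ y ∷ [])

  membershipGraph : Structure 𝓛-graph
  membershipGraph = record
    { Carrier = Carrier 𝔐
    ; interp  = λ where
        E (x ∷ y ∷ []) → (x ∈ᴹ y) ⊎ (y ∈ᴹ x)
        D (x ∷ y ∷ []) → (x ∈ᴹ y) × (y ∈ᴹ x)
    }

{-# OPTIONS --safe #-}
module Submission where

-- For S ⊆ ℕ and a bound K, a flat system whose indeterminates form the path
-- 0, 1, …, K of double edges, with a loop at n exactly when n ∈ S, has a solution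
-- that is a whole component of the double-edge graph.  A walk from 0 that never
-- stalls or turns back at once is forced along the path, so the formulas ψₙ(x) = "some
-- such walk of length n from x ends at a loop" are independent in the membership graph.
-- Diagonalising against the countably many elements gives a type, consisting of ψₙ or
-- ¬ ψₙ for each n, that is finitely satisfiable but omitted.  A countable elementarily
-- equivalent structure realizing it, hence not isomorphic to the graph, is obtained by
-- closing a sequence of approximate realizations under Skolem functions, modulo an
-- ultrafilter on the countably many events that matter.

open import Defs
open import Axiom.ExcludedMiddle using (ExcludedMiddle)
open import Data.Empty using (⊥; ⊥-elim)
open import Data.Fin.Base using (Fin; zero; suc; toℕ; fromℕ<; inject₁)
open import Data.Fin.Patterns using (0F; 1F)
open import Data.Fin.Properties using (toℕ-injective; toℕ<n; toℕ-fromℕ<; toℕ-inject₁)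
open import Data.Maybe.Base as Maybe using (Maybe; just; nothing; zipWith; _>>=_)
open import Data.Nat.Base
open import Data.Nat.Induction using (<-rec)
open import Data.Nat.Properties
open import Data.Product.Base using (Σ; Σ-syntax; ∃; _×_; _,_; proj₁; proj₂)
open import Data.Sum.Base using (_⊎_; inj₁; inj₂; [_,_]′)
open import Data.Unit.Base using (⊤; tt)
open import Data.Vec.Base using (Vec; []; _∷_; lookup; map)
open import Data.Vec.Properties using (lookup-map; map-cong; map-∘)
open import Function.Base using (_∘_; id; case_of_)
open import Function.Bundles using (_⇔_; _↣_; mk↣; mk⇔; module Injection; module Bijection; module Equivalence)
open import Level using (0ℓ)
open import Relation.Binary.PropositionalEquality hiding (J)
open import Relation.Nullary.Decidable.Core using (yes; no; decidable-stable)
open import Relation.Nullary.Negation.Core using (¬_; contradiction)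

-- Countability of the syntax

opaque

  -- The number 2^a (2b + 1); parity recovers a, one factor 2 at a time, and then b.
  ⟪_,_⟫ : ℕ → ℕ → ℕ
  ⟪ zero  , b ⟫ = suc (2 * b)
  ⟪ suc a , b ⟫ = 2 * ⟪ a , b ⟫

  ⟪,⟫-injective : ∀ {a b c d} → ⟪ a , b ⟫ ≡ ⟪ c , d ⟫ → a ≡ c × b ≡ d
  ⟪,⟫-injective {zero}  {b} {zero}  {d} eq = refl , *-cancelˡ-≡ b d 2 (suc-injective eq)
  ⟪,⟫-injective {zero}  {b} {suc c} {d} eq = contradiction (sym eq) (even≢odd ⟪ c , d ⟫ b)
  ⟪,⟫-injective {suc a} {b} {zero}  {d} eq = contradiction eq (even≢odd ⟪ a , b ⟫ d)
  ⟪,⟫-injective {suc a} {b} {suc c} {d} eq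
    with refl , b≡d ← ⟪,⟫-injective {a} {b} {c} {d} (*-cancelˡ-≡ ⟪ a , b ⟫ ⟪ c , d ⟫ 2 eq) =
    refl , b≡d

vecCode : ∀ {A : Set} {n} → (A → ℕ) → Vec A n → ℕ
vecCode f []       = 0
vecCode f (x ∷ xs) = ⟪ f x , vecCode f xs ⟫

vecCode-injective : ∀ {A : Set} {n} {f : A → ℕ} → (∀ {x y} → f x ≡ f y → x ≡ y) →
                    {xs ys : Vec A n} → vecCode f xs ≡ vecCode f ys → xs ≡ ys
vecCode-injective inj {[]}     {[]}     _  = refl
vecCode-injective inj {x ∷ xs} {y ∷ ys} eq
  with p , q ← ⟪,⟫-injective eq = cong₂ _∷_ (inj p) (vecCode-injective inj q)

data Code : Set where
  atom : ℕ → Code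
  op   : ℕ → Code → Code → Code

number : Code → ℕ
number (atom n)   = ⟪ 0 , n ⟫
number (op k a b) = ⟪ suc k , ⟪ number a , number b ⟫ ⟫

number-injective : ∀ {a b} → number a ≡ number b → a ≡ b
number-injective {atom _}   {atom _}   eq = cong atom (proj₂ (⟪,⟫-injective eq))
number-injective {atom _}   {op k _ _} eq = case proj₁ (⟪,⟫-injective eq) of λ ()
number-injective {op k _ _} {atom _}   eq = case proj₁ (⟪,⟫-injective eq) of λ ()
number-injective {op k a b} {op l c d} eq
  with refl , p ← ⟪,⟫-injective eq
  with q , r ← ⟪,⟫-injective p =
  cong₂ (op k) (number-injective q) (number-injective r)

-- Isomorphisms

map-lookup : ∀ {A B : Set} {m n} (f : A → B) (ρ : Vec A n) (xs : Vec (Fin n) m) →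
             map f (map (lookup ρ) xs) ≡ map (lookup (map f ρ)) xs
map-lookup f ρ xs = trans (sym (map-∘ f (lookup ρ) xs))
  (map-cong (λ x → sym (lookup-map x f ρ)) xs)

module Isomorphism {𝓛 : Language} {𝔄 𝔅 : Structure 𝓛} (iso : 𝔄 ≅ 𝔅) where

  open _≅_ iso
  open Bijection bijection using (injective; strictlySurjective)
  open Equivalence using (from) renaming (to to forward)

  -- The two directions are mutual because an implication exchanges them; surjectivity handles the
  -- quantifiers and injectivity the equations.
  preserves⁺ : ∀ {n} (φ : Formula 𝓛 n) ρ → 𝔄 , ρ ⊨′ φ → 𝔅 , map to ρ ⊨′ φ
  preserves⁻ : ∀ {n} (φ : Formula 𝓛 n) ρ → 𝔅 , map to ρ ⊨′ φ → 𝔄 , ρ ⊨′ φ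

  preserves⁺ (rel R xs) ρ p =
    subst (interp 𝔅 R) (map-lookup to ρ xs) (forward (preserves R _) p)
  preserves⁺ (x ≐ y) ρ eq =
    trans (lookup-map x to ρ) (trans (cong to eq) (sym (lookup-map y to ρ)))
  preserves⁺ (φ ∧′ ψ) ρ (p , q) = preserves⁺ φ ρ p , preserves⁺ ψ ρ q
  preserves⁺ (φ ∨′ ψ) ρ (inj₁ p) = inj₁ (preserves⁺ φ ρ p)
  preserves⁺ (φ ∨′ ψ) ρ (inj₂ q) = inj₂ (preserves⁺ ψ ρ q)
  preserves⁺ (φ ⇒′ ψ) ρ f p = preserves⁺ ψ ρ (f (preserves⁻ φ ρ p))
  preserves⁺ (∀′ φ) ρ f b with a , refl ← strictlySurjective b = preserves⁺ φ (a ∷ ρ) (f a)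
  preserves⁺ (∃′ φ) ρ (a , p) = to a , preserves⁺ φ (a ∷ ρ) p

  preserves⁻ (rel R xs) ρ p =
    from (preserves R _) (subst (interp 𝔅 R) (sym (map-lookup to ρ xs)) p)
  preserves⁻ (x ≐ y) ρ eq =
    injective (trans (sym (lookup-map x to ρ)) (trans eq (lookup-map y to ρ)))
  preserves⁻ (φ ∧′ ψ) ρ (p , q) = preserves⁻ φ ρ p , preserves⁻ ψ ρ q
  preserves⁻ (φ ∨′ ψ) ρ (inj₁ p) = inj₁ (preserves⁻ φ ρ p)
  preserves⁻ (φ ∨′ ψ) ρ (inj₂ q) = inj₂ (preserves⁻ ψ ρ q)
  preserves⁻ (φ ⇒′ ψ) ρ f p = preserves⁻ ψ ρ (f (preserves⁺ φ ρ p))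
  preserves⁻ (∀′ φ) ρ f a = preserves⁻ φ (a ∷ ρ) (f (to a))
  preserves⁻ (∃′ φ) ρ (b , p) with a , refl ← strictlySurjective b = a , preserves⁻ φ (a ∷ ρ) p

-- Classical search and the numbering of formulas

module Classical (em : ExcludedMiddle 0ℓ) where

  byContradiction : {P : Set} → ¬ ¬ P → P
  byContradiction = decidable-stable em

  inverse : {A : Set} → (A → ℕ) → ℕ → Maybe A
  inverse {A} f n with em {Σ[ x ∈ A ] f x ≡ n}
  ... | yes (x , _) = just x
  ... | no _        = nothing

  inverse-just : {A : Set} {f : A → ℕ} → (∀ {x y} → f x ≡ f y → x ≡ y) →
                 ∀ x → inverse f (f x) ≡ just x
  inverse-just {A} {f} inj x with em {Σ[ y ∈ A ] f y ≡ f x}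
  ... | yes (_ , eq) = cong just (inj eq)
  ... | no ∄         = contradiction (x , refl) ∄

  leastWitness : {P : ℕ → Set} → ∃ P → Σ[ n ∈ ℕ ] P n × (∀ m → P m → n ≤ m)
  leastWitness {P} (n , Pn) = <-rec (λ n → P n → _) step n Pn
    where
    step : ∀ n → (∀ {k} → k < n → P k → Σ[ n ∈ ℕ ] P n × (∀ m → P m → n ≤ m)) →
           P n → Σ[ n ∈ ℕ ] P n × (∀ m → P m → n ≤ m)
    step n below Pn with em {Σ[ k ∈ ℕ ] k < n × P k}
    ... | yes (k , k<n , Pk) = below k<n Pk
    ... | no ∄               = n , Pn , λ m Pm → ≮⇒≥ (λ m<n → ∄ (m , m<n , Pm))

  module FormulaCode {𝓛 : Language} (relCode : Rel 𝓛 ↣ ℕ) where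

    open Injection relCode using () renaming (to to relNumber; injective to relNumber-injective)

    encode : ∀ {n} → Formula 𝓛 n → Code
    encode (rel R xs) = op 0 (atom (relNumber R)) (atom (vecCode toℕ xs))
    encode (x ≐ y)    = op 1 (atom (toℕ x)) (atom (toℕ y))
    encode ⊥′         = atom 0
    encode (φ ∧′ ψ)   = op 2 (encode φ) (encode ψ)
    encode (φ ∨′ ψ)   = op 3 (encode φ) (encode ψ)
    encode (φ ⇒′ ψ)   = op 4 (encode φ) (encode ψ)
    encode (∀′ φ)     = op 5 (encode φ) (atom 0)
    encode (∃′ φ)     = op 6 (encode φ) (atom 0)

    -- A left inverse of `encode` yields injectivity without comparing all pairs of constructors.
    decode : ∀ n → Code → Maybe (Formula 𝓛 n)
    decode n (op 0 (atom r) (atom v)) =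
      inverse relNumber r >>= λ R → Maybe.map (rel R) (inverse (vecCode toℕ) v)
    decode n (op 1 (atom x) (atom y)) = zipWith _≐_ (inverse toℕ x) (inverse toℕ y)
    decode n (op 2 a b)        = zipWith _∧′_ (decode n a) (decode n b)
    decode n (op 3 a b)        = zipWith _∨′_ (decode n a) (decode n b)
    decode n (op 4 a b)        = zipWith _⇒′_ (decode n a) (decode n b)
    decode n (op 5 a _)        = Maybe.map ∀′ (decode (suc n) a)
    decode n (op 6 a _)        = Maybe.map ∃′ (decode (suc n) a)
    -- This clause serves `atom 0`, the code of `⊥′`; on the remaining codes the result is
    -- arbitrary.
    decode n _                 = just ⊥′

    decode-encode : ∀ {n} (φ : Formula 𝓛 n) → decode n (encode φ) ≡ just φ
    decode-encode (rel R xs)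
      rewrite inverse-just relNumber-injective R
            | inverse-just (vecCode-injective toℕ-injective) xs = refl
    decode-encode (x ≐ y)
      rewrite inverse-just toℕ-injective x | inverse-just toℕ-injective y = refl
    decode-encode ⊥′       = refl
    decode-encode (φ ∧′ ψ) rewrite decode-encode φ | decode-encode ψ = refl
    decode-encode (φ ∨′ ψ) rewrite decode-encode φ | decode-encode ψ = refl
    decode-encode (φ ⇒′ ψ) rewrite decode-encode φ | decode-encode ψ = refl
    decode-encode (∀′ φ)   rewrite decode-encode φ = refl
    decode-encode (∃′ φ)   rewrite decode-encode φ = refl

    opaque

      formulaCode : ∀ {n} → Formula 𝓛 n → ℕ
      formulaCode = number ∘ encode

      formulaCode-injective : ∀ {n} {φ ψ : Formula 𝓛 n} → formulaCode φ ≡ formulaCode ψ → φ ≡ ψ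
      formulaCode-injective {n} {φ} {ψ} eq with refl ← trans (sym (decode-encode φ))
        (trans (cong (decode n) (number-injective {encode φ} {encode ψ} eq)) (decode-encode ψ)) = refl

  -- Ultrafilters on countably many events

  Infinite : (ℕ → Set) → Set
  Infinite I = ∀ n → Σ[ k ∈ ℕ ] n ≤ k × I k

  -- If beyond some n no element of I failed P, then the part of I beyond n would lie inside P,
  -- making the first alternative true.
  infinite-split : ∀ {I : ℕ → Set} (P : ℕ → Set) → Infinite I →
                   Infinite (λ k → I k × P k) ⊎ Infinite (λ k → I k × ¬ P k)
  infinite-split {I} P inf with em {Infinite (λ k → I k × P k)}
  ... | yes p = inj₁ p
  ... | no ¬p = inj₂ λ n → byContradiction λ ∄ → ¬p λ m →
    let k , m⊔n≤k , Ik = inf (m ⊔ n)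
    in k , m⊔n≤o⇒m≤o m n m⊔n≤k , Ik ,
       byContradiction λ ¬Pk → ∄ (k , m⊔n≤o⇒n≤o m n m⊔n≤k , Ik , ¬Pk)

  -- One step towards a non-principal ultrafilter: `decides` settles a single event, and `above`
  -- discards the numbers below e.
  record Refinement (I : ℕ → Set) (e : ℕ) (P : ℕ → Set) : Set₁ where
    field
      J        : ℕ → Set
      infinite : Infinite J
      shrinks  : ∀ {k} → J k → I k
      above    : ∀ {k} → J k → e ≤ k
      decides  : (∀ {k} → J k → P k) ⊎ (∀ {k} → J k → ¬ P k)

  above-infinite : ∀ {I : ℕ → Set} e → Infinite I → Infinite (λ k → e ≤ k × I k)
  above-infinite e inf n =
    let k , e⊔n≤k , Ik = inf (e ⊔ n)
    in k , m⊔n≤o⇒n≤o e n e⊔n≤k , m⊔n≤o⇒m≤o e n e⊔n≤k , Ik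

  refine : ∀ {I} → Infinite I → ∀ e P → Refinement I e P
  refine inf e P with infinite-split P (above-infinite e inf)
  ... | inj₁ inf′ = record
    { infinite = inf′ ; shrinks = proj₂ ∘ proj₁ ; above = proj₁ ∘ proj₁ ; decides = inj₁ proj₂ }
  ... | inj₂ inf′ = record
    { infinite = inf′ ; shrinks = proj₂ ∘ proj₁ ; above = proj₁ ∘ proj₁ ; decides = inj₂ proj₂ }

  module Ultrafilter {X : Set} (code : X ↣ ℕ) (event : X → ℕ → Set) where

    open Injection code using (to; injective)
    open Refinement

    -- As `code` is injective, this is the event of x when e is the code of x; when e codes nothing
    -- it holds vacuously. Every e thus gets an event.
    eventNumber : ℕ → ℕ → Set
    eventNumber e k = ∀ x → to x ≡ e → event x k

    stage : ℕ → Σ (ℕ → Set) Infinite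
    refinement : ∀ e → Refinement (proj₁ (stage e)) e (eventNumber e)

    stage zero    = (λ _ → ⊤) , λ n → n , ≤-refl , tt
    stage (suc e) = J (refinement e) , infinite (refinement e)

    refinement e = refine (proj₂ (stage e)) e (eventNumber e)

    stage-antitone : ∀ {d e} → d ≤ e → ∀ {k} → proj₁ (stage e) k → proj₁ (stage d) k
    stage-antitone {d} d≤e = go (≤⇒≤′ d≤e)
      where
      go : ∀ {e} → d ≤′ e → ∀ {k} → proj₁ (stage e) k → proj₁ (stage d) k
      go ≤′-refl               = id
      go (≤′-step {e} d≤′e)    = go d≤′e ∘ shrinks (refinement e)

    -- The filter generated by the decreasing stages. It is only guaranteed to decide the coded
    -- events, which is the part of being an ultrafilter that Łoś's theorem uses below.
    U : (ℕ → Set) → Set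
    U P = Σ[ e ∈ ℕ ] (∀ k → proj₁ (stage e) k → P k)

    U-all : ∀ {P} → (∀ k → P k) → U P
    U-all p = 0 , λ k _ → p k

    U-from : ∀ n → U (n ≤_)
    U-from n = suc n , λ k → above (refinement n)

    U-map : ∀ {P Q : ℕ → Set} → (∀ k → P k → Q k) → U P → U Q
    U-map f (e , p) = e , λ k → f k ∘ p k

    U-zip : ∀ {P Q R : ℕ → Set} → (∀ k → P k → Q k → R k) → U P → U Q → U R
    U-zip f (d , p) (e , q) = d ⊔ e , λ k i →
      f k (p k (stage-antitone (m≤m⊔n d e) i)) (q k (stage-antitone (m≤n⊔m d e) i))

    U-∅ : ¬ U (λ _ → ⊥)
    U-∅ (e , p) = let k , _ , i = proj₂ (stage e) 0 in p k i

    U-decides : ∀ x → U (event x) ⊎ U (λ k → ¬ event x k)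
    U-decides x with decides (refinement (to x))
    ... | inj₁ p = inj₁ (suc (to x) , λ k i → p i x refl)
    ... | inj₂ p = inj₂ (suc (to x) , λ k i e → p i λ y eq →
                     subst (λ z → event z k) (injective (sym eq)) e)

  -- Countable structures built from definable Skolem functions

  module Skolem {𝓛 : Language} (relCode : Rel 𝓛 ↣ ℕ) (𝔐 : Structure 𝓛)
                (point : ℕ → Carrier 𝔐) where

    open FormulaCode {𝓛} relCode

    -- A Skolem function for φ: excluded middle, applied to a Σ-type, returns the witness itself.
    -- Where there is none, `point 0` is a dummy value.
    choose : ∀ {n} → Formula 𝓛 (suc n) → Vec (Carrier 𝔐) n → Carrier 𝔐
    choose φ ρ with em {𝔐 , ρ ⊨′ ∃′ φ}
    ... | yes (a , _) = a
    ... | no _        = point 0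

    choose-correct : ∀ {n} (φ : Formula 𝓛 (suc n)) {ρ} → 𝔐 , ρ ⊨′ ∃′ φ → 𝔐 , choose φ ρ ∷ ρ ⊨′ φ
    choose-correct φ {ρ} h with em {𝔐 , ρ ⊨′ ∃′ φ}
    ... | yes (_ , p) = p
    ... | no ∄        = contradiction h ∄

    -- Names for elements of a reduced power of `𝔐`: `base` names the sequence `point`, and
    -- `witness` applies a Skolem function in each coordinate. Restricting to named elements keeps
    -- the structure countable.
    data Term : Set where
      base    : Term
      witness : ∀ {n} → Formula 𝓛 (suc n) → Vec Term n → Term

    value  : Term → ℕ → Carrier 𝔐
    values : ∀ {n} → Vec Term n → ℕ → Vec (Carrier 𝔐) n

    value base           k = point k
    value (witness φ ts) k = choose φ (values ts k)

    values []       k = []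
    values (t ∷ ts) k = value t k ∷ values ts k

    termCode  : Term → ℕ
    termCodes : ∀ {n} → Vec Term n → ℕ

    termCode base               = 0
    termCode (witness {n} φ ts) = suc ⟪ n , ⟪ formulaCode φ , termCodes ts ⟫ ⟫

    termCodes []       = 0
    termCodes (t ∷ ts) = ⟪ termCode t , termCodes ts ⟫

    termCode-injective  : ∀ t u → termCode t ≡ termCode u → t ≡ u
    termCodes-injective : ∀ {n} (ts us : Vec Term n) → termCodes ts ≡ termCodes us → ts ≡ us

    termCode-injective base           base           eq = refl
    termCode-injective (witness {n} φ ts) (witness {m} ψ us) eq
      with refl , p ← ⟪,⟫-injective (suc-injective eq)
      with q , r ← ⟪,⟫-injective p =
      cong₂ witness (formulaCode-injective q) (termCodes-injective ts us r)

    termCodes-injective []       []       eq = refl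
    termCodes-injective (t ∷ ts) (u ∷ us) eq
      with p , q ← ⟪,⟫-injective eq =
      cong₂ _∷_ (termCode-injective t u p) (termCodes-injective ts us q)

    -- Formulas with named parameters: the countably many events that the filter has to decide.
    Statement : Set
    Statement = Σ[ n ∈ ℕ ] Formula 𝓛 n × Vec Term n

    statementNumber : Statement → ℕ
    statementNumber (n , φ , ts) = ⟪ n , ⟪ formulaCode φ , termCodes ts ⟫ ⟫

    statementNumber-injective : ∀ s t → statementNumber s ≡ statementNumber t → s ≡ t
    statementNumber-injective (n , φ , ts) (m , ψ , us) eq
      with refl , p ← ⟪,⟫-injective eq
      with q , r ← ⟪,⟫-injective p =
      cong₂ (λ φ ts → n , φ , ts) (formulaCode-injective q) (termCodes-injective ts us r)

    statementCode : Statement ↣ ℕ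
    statementCode = mk↣ λ {s} {t} → statementNumber-injective s t

    open Ultrafilter statementCode (λ (n , φ , ts) k → 𝔐 , values ts k ⊨′ φ) public

    infix 4 _∼_

    _∼_ : Term → Term → Set
    t ∼ u = U (λ k → value t k ≡ value u k)

    ∼-refl : ∀ t → t ∼ t
    ∼-refl _ = U-all λ _ → refl

    ∼-sym : ∀ t u → t ∼ u → u ∼ t
    ∼-sym _ _ = U-map λ _ → sym

    ∼-trans : ∀ t u v → t ∼ u → u ∼ v → t ∼ v
    ∼-trans _ _ _ = U-zip λ _ → trans

    leastCode : ∀ t → Σ[ n ∈ ℕ ] (Σ[ u ∈ Term ] termCode u ≡ n × u ∼ t) ×
                       (∀ m → (Σ[ u ∈ Term ] termCode u ≡ m × u ∼ t) → n ≤ m)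
    leastCode t = leastWitness (termCode t , t , refl , ∼-refl t)

    least : Term → ℕ
    least = proj₁ ∘ leastCode

    least-antitone : ∀ t u → t ∼ u → least t ≤ least u
    least-antitone t u t∼u =
      let n , (v , eq , v∼u) , _ = leastCode u
      in proj₂ (proj₂ (leastCode t)) n (v , eq , ∼-trans v u t v∼u (∼-sym t u t∼u))

    least-cong : ∀ t u → t ∼ u → least t ≡ least u
    least-cong t u t∼u = ≤-antisym (least-antitone t u t∼u) (least-antitone u t (∼-sym t u t∼u))

    -- Quotients are not available: a class is represented by its member
    -- of least code.
    Canonical : Set
    Canonical = Σ[ t ∈ Term ] termCode t ≡ least t

    canonical-≡ : ∀ {a b : Canonical} → proj₁ a ≡ proj₁ b → a ≡ b
    canonical-≡ {t , p} {_ , q} refl = cong (t ,_) (≡-irrelevant p q)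

    canonical-∼ : ∀ {a b : Canonical} → proj₁ a ∼ proj₁ b → a ≡ b
    canonical-∼ {t , p} {u , q} t∼u =
      canonical-≡ (termCode-injective t u (trans p (trans (least-cong t u t∼u) (sym q))))

    canonical : Term → Canonical
    canonical t = let _ , (u , eq , u∼t) , _ = leastCode t in u , trans eq (sym (least-cong u t u∼t))

    canonical-∼-self : ∀ t → proj₁ (canonical t) ∼ t
    canonical-∼-self t = proj₂ (proj₂ (proj₁ (proj₂ (leastCode t))))

    at : ℕ → Canonical → Carrier 𝔐
    at k a = value (proj₁ a) k

    𝔅 : Structure 𝓛
    𝔅 = record
      { Carrier = Canonical
      ; interp  = λ R as → U (λ k → interp 𝔐 R (map (at k) as))
      }

    𝔅-countable : Countable 𝔅
    𝔅-countable = mk↣ {to = termCode ∘ proj₁} λ {a} {b} eq →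
      canonical-≡ (termCode-injective (proj₁ a) (proj₁ b) eq)

    values-map : ∀ {n} k (ρ : Vec Canonical n) → values (map proj₁ ρ) k ≡ map (at k) ρ
    values-map k []      = refl
    values-map k (a ∷ ρ) = cong (_ ∷_) (values-map k ρ)

    truth-decided : ∀ {n} (φ : Formula 𝓛 n) (ρ : Vec Canonical n) →
      U (λ k → 𝔐 , map (at k) ρ ⊨′ φ) ⊎ U (λ k → ¬ (𝔐 , map (at k) ρ ⊨′ φ))
    truth-decided φ ρ with U-decides (_ , φ , map proj₁ ρ)
    ... | inj₁ u = inj₁ (U-map (λ k → subst (λ σ → 𝔐 , σ ⊨′ φ) (values-map k ρ)) u)
    ... | inj₂ u = inj₂ (U-map (λ k ¬p p → ¬p (subst (λ σ → 𝔐 , σ ⊨′ φ) (sym (values-map k ρ)) p)) u)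

    -- The coordinatewise witnesses are the values of a single Skolem term, so they make up an
    -- element of the countable structure.
    witnessed : ∀ {n} (φ : Formula 𝓛 (suc n)) (ρ : Vec Canonical n) →
      U (λ k → 𝔐 , map (at k) ρ ⊨′ ∃′ φ) →
      Σ[ a ∈ Canonical ] U (λ k → 𝔐 , map (at k) (a ∷ ρ) ⊨′ φ)
    witnessed φ ρ u = canonical t , U-zip
      (λ k p eq → subst (λ b → 𝔐 , b ∷ map (at k) ρ ⊨′ φ) (sym eq)
        (subst (λ σ → 𝔐 , choose φ σ ∷ map (at k) ρ ⊨′ φ) (sym (values-map k ρ))
          (choose-correct φ p)))
      u (canonical-∼-self t)
      where t = witness φ (map proj₁ ρ)

    -- Łoś's theorem. The directions are mutual because of implication; deciding the events handles
    -- disjunction, implication and ∀, and `witnessed` supplies the elements for the quantifiers.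
    łoś⁺ : ∀ {n} (φ : Formula 𝓛 n) ρ → 𝔅 , ρ ⊨′ φ → U (λ k → 𝔐 , map (at k) ρ ⊨′ φ)
    łoś⁻ : ∀ {n} (φ : Formula 𝓛 n) ρ → U (λ k → 𝔐 , map (at k) ρ ⊨′ φ) → 𝔅 , ρ ⊨′ φ

    łoś⁺ (rel R xs) ρ u = U-map (λ k → subst (interp 𝔐 R) (map-lookup (at k) ρ xs)) u
    łoś⁺ (x ≐ y) ρ eq = U-all λ k →
      trans (lookup-map x (at k) ρ) (trans (cong (at k) eq) (sym (lookup-map y (at k) ρ)))
    łoś⁺ ⊥′ ρ ()
    łoś⁺ (φ ∧′ ψ) ρ (p , q) = U-zip (λ _ → _,_) (łoś⁺ φ ρ p) (łoś⁺ ψ ρ q)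
    łoś⁺ (φ ∨′ ψ) ρ (inj₁ p) = U-map (λ _ → inj₁) (łoś⁺ φ ρ p)
    łoś⁺ (φ ∨′ ψ) ρ (inj₂ q) = U-map (λ _ → inj₂) (łoś⁺ ψ ρ q)
    łoś⁺ (φ ⇒′ ψ) ρ f with truth-decided φ ρ
    ... | inj₁ u = U-map (λ _ q _ → q) (łoś⁺ ψ ρ (f (łoś⁻ φ ρ u)))
    ... | inj₂ u = U-map (λ _ ¬p p → contradiction p ¬p) u
    łoś⁺ (∀′ φ) ρ f with truth-decided (∀′ φ) ρ
    ... | inj₁ u = u
    ... | inj₂ u =
      -- A Skolem term for `¬′ φ` names a counterexample on a set of the filter, which `f` at that
      -- term contradicts.
      let a , v = witnessed (¬′ φ) ρ
                    (U-map (λ k ¬∀ → byContradiction λ ∄ →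
                       ¬∀ λ a → byContradiction λ ¬p → ∄ (a , ¬p)) u)
      in ⊥-elim (U-∅ (U-zip (λ _ ¬p p → ¬p p) v (łoś⁺ φ (a ∷ ρ) (f a))))
    łoś⁺ (∃′ φ) ρ (a , p) = U-map (λ k q → at k a , q) (łoś⁺ φ (a ∷ ρ) p)

    łoś⁻ (rel R xs) ρ u = U-map (λ k → subst (interp 𝔐 R) (sym (map-lookup (at k) ρ xs))) u
    łoś⁻ (x ≐ y) ρ u = canonical-∼ (U-map (λ k eq →
      trans (sym (lookup-map x (at k) ρ)) (trans eq (lookup-map y (at k) ρ))) u)
    łoś⁻ ⊥′ ρ u = U-∅ u
    łoś⁻ (φ ∧′ ψ) ρ u = łoś⁻ φ ρ (U-map (λ _ → proj₁) u) , łoś⁻ ψ ρ (U-map (λ _ → proj₂) u)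
    łoś⁻ (φ ∨′ ψ) ρ u with truth-decided φ ρ
    ... | inj₁ v = inj₁ (łoś⁻ φ ρ v)
    ... | inj₂ v = inj₂ (łoś⁻ ψ ρ (U-zip (λ { _ (inj₁ p) ¬p → contradiction p ¬p
                                             ; _ (inj₂ q) _ → q }) u v))
    łoś⁻ (φ ⇒′ ψ) ρ u p = łoś⁻ ψ ρ (U-zip (λ _ f x → f x) u (łoś⁺ φ ρ p))
    łoś⁻ (∀′ φ) ρ u a = łoś⁻ φ (a ∷ ρ) (U-map (λ k f → f (at k a)) u)
    łoś⁻ (∃′ φ) ρ u = let a , v = witnessed φ ρ u in a , łoś⁻ φ (a ∷ ρ) v

  -- Realizing and omitting a type

  compactness : ∀ {𝓛} → Rel 𝓛 ↣ ℕ → (𝔐 : Structure 𝓛) (p : ℕ → Formula 𝓛 1) →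
    (∀ k → Σ[ a ∈ Carrier 𝔐 ] (∀ n → n ≤ k → 𝔐 , a ∷ [] ⊨′ p n)) →
    Σ[ 𝔅 ∈ Structure 𝓛 ] Countable 𝔅 × 𝔅 ⊨ᵗ Th 𝔐 ×
      (Σ[ b ∈ Carrier 𝔅 ] (∀ n → 𝔅 , b ∷ [] ⊨′ p n))
  compactness {𝓛} relCode 𝔐 p sat = 𝔅 , 𝔅-countable ,
    (λ φ 𝔐⊨φ → łoś⁻ φ [] (U-all λ _ → 𝔐⊨φ)) , canonical base ,
    -- The k-th value of `base` satisfies p 0, ..., p k, so p n can fail only at some k < n, and the
    -- filter contains the set of all k ≥ n.
    λ n → łoś⁻ (p n) _ (U-zip
      (λ k n≤k eq → subst (λ a → 𝔐 , a ∷ [] ⊨′ p n) (sym eq) (proj₂ (sat k) n n≤k))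
      (U-from n) (canonical-∼-self base))
    where open Skolem {𝓛} relCode 𝔐 (proj₁ ∘ sat)

  -- Independence makes the diagonal type `p` finitely satisfiable, hence realized in a countable
  -- elementarily equivalent `𝔅`. An isomorphism would carry the realization into `𝔐`, where every
  -- element violates `p` at its own index.
  independent⇒¬ℵ₀-categorical : ∀ {𝓛} → Rel 𝓛 ↣ ℕ → (𝔐 : Structure 𝓛) → Countable 𝔐 →
    (ψ : ℕ → Formula 𝓛 1) →
    (∀ (S : ℕ → Set) k →
       Σ[ a ∈ Carrier 𝔐 ] (∀ n → n ≤ k → (𝔐 , a ∷ [] ⊨′ ψ n) ⇔ S n)) →
    ¬ ℵ₀-Categorical 𝔐
  independent⇒¬ℵ₀-categorical {𝓛} relCode 𝔐 countable ψ independent categorical =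
    avoided (iso-to b) λ n → preserves⁺ (p n) (b ∷ []) (b-realizes n)
    where
    open Injection countable using () renaming (to to index; injective to index-injective)
    open Equivalence

    -- Cantor's diagonal: `p n` is whichever of ψ n and its negation is false at the element of
    -- index n. If n is no index, `p n` is the negation.
    S : ℕ → Set
    S n = Σ[ a ∈ Carrier 𝔐 ] index a ≡ n × ¬ (𝔐 , a ∷ [] ⊨′ ψ n)

    p : ℕ → Formula 𝓛 1
    p n with em {S n}
    ... | yes _ = ψ n
    ... | no _  = ¬′ ψ n

    p-finitely-satisfiable : ∀ k → Σ[ a ∈ Carrier 𝔐 ] (∀ n → n ≤ k → 𝔐 , a ∷ [] ⊨′ p n)
    p-finitely-satisfiable k with a , agrees ← independent S k = a , holds
      where
      holds : ∀ n → n ≤ k → 𝔐 , a ∷ [] ⊨′ p n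
      holds n n≤k with em {S n}
      ... | yes Sn = from (agrees n n≤k) Sn
      ... | no ¬Sn = ¬Sn ∘ to (agrees n n≤k)

    avoided : ∀ a → ¬ (∀ n → 𝔐 , a ∷ [] ⊨′ p n)
    avoided a all with em {S (index a)} | all (index a)
    ... | yes (a′ , eq , ¬ψ) | ψa with refl ← index-injective eq = ¬ψ ψa
    ... | no ¬S              | ¬ψ = ¬S (a , refl , ¬ψ)

    realization = compactness {𝓛} relCode 𝔐 p p-finitely-satisfiable

    𝔅 : Structure 𝓛
    𝔅 = proj₁ realization

    iso : 𝔅 ≅ 𝔐
    iso = categorical 𝔅 (proj₁ (proj₂ realization)) (proj₁ (proj₂ (proj₂ realization)))

    b : Carrier 𝔅
    b = proj₁ (proj₂ (proj₂ (proj₂ realization)))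

    b-realizes : ∀ n → 𝔅 , b ∷ [] ⊨′ p n
    b-realizes = proj₂ (proj₂ (proj₂ (proj₂ realization)))

    open _≅_ iso using () renaming (to to iso-to)
    open Isomorphism iso

-- Finite sets and flat systems in a model of ZFA

infix 1 _iff_

_iff_ : Set → Set → Set
A iff B = (A → B) × (B → A)

module SetTheory (em : ExcludedMiddle 0ℓ) (𝔐 : Structure 𝓛-set) (zfa : 𝔐 ⊨ᵗ ZFA) where

  V : Set
  V = Carrier 𝔐

  infix 4 _∈_

  _∈_ : V → V → Set
  x ∈ y = interp 𝔐 mem (x ∷ y ∷ [])

  -- These predicates, written with `_iff_`, unfold to the same types as satisfaction of the
  -- corresponding formulas, so the axioms apply directly as functions.
  IsUnorderedPair IsOrderedPair IsValue : V → V → V → Set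
  IsUnorderedPair c a b = ∀ z → z ∈ c iff (z ≡ a ⊎ z ≡ b)
  IsOrderedPair p a b = ∀ z → z ∈ p iff (IsUnorderedPair z a a ⊎ IsUnorderedPair z a b)
  IsValue f x y = Σ[ p ∈ V ] p ∈ f × IsOrderedPair p x y

  IsFunction : V → V → Set
  IsFunction f d =
      (∀ p → p ∈ f → Σ[ x ∈ V ] x ∈ d × Σ[ y ∈ V ] IsOrderedPair p x y)
    × (∀ x → x ∈ d → Σ[ y ∈ V ] IsValue f x y × (∀ y′ → IsValue f x y′ → y′ ≡ y))

  IsFlat : V → V → V → Set
  IsFlat X A S =
      (∀ z → z ∈ X → ¬ z ∈ A) × IsFunction S X
    × (∀ x → x ∈ X → ∀ t → IsValue S x t → ∀ z → z ∈ t → z ∈ X ⊎ z ∈ A)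

  IsSolution : V → V → V → V → Set
  IsSolution X A S s =
      IsFunction s X
    × (∀ x → x ∈ X → ∀ t v → IsValue S x t × IsValue s x v →
       ∀ z → z ∈ v iff ((Σ[ y ∈ V ] y ∈ t × y ∈ X × IsValue s y z) ⊎ (z ∈ t × z ∈ A)))

  opaque

    extensional : ∀ {a b} → (∀ z → z ∈ a iff z ∈ b) → a ≡ b
    extensional = zfa Extensionality extensionality _ _

    pairing-axiom : ∀ a b → Σ[ c ∈ V ] IsUnorderedPair c a b
    pairing-axiom = zfa Pairing pairing

    union-axiom : ∀ f → Σ[ u ∈ V ] (∀ z → z ∈ u iff (Σ[ y ∈ V ] y ∈ f × z ∈ y))
    union-axiom = zfa Union union

    afa : ∀ X A S → IsFlat X A S → Σ[ s ∈ V ] IsSolution X A S s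
    afa X A S flat = let s , solves , _ = zfa AntiFoundation antiFoundation X A S flat in s , solves

    ∅ : V
    ∅ = let _ , (e , _) , _ = zfa Infinity infinity in e

    ∉∅ : ∀ {z} → ¬ z ∈ ∅
    ∉∅ {z} = let _ , (_ , _ , empty) , _ = zfa Infinity infinity in empty z

  ｛_｝ : V → V
  ｛ a ｝ = proj₁ (pairing-axiom a a)

  ∈｛｝⁻ : ∀ {a z} → z ∈ ｛ a ｝ → z ≡ a
  ∈｛｝⁻ {a} {z} = [ id , id ]′ ∘ proj₁ (proj₂ (pairing-axiom a a) z)

  ∈｛｝⁺ : ∀ {a} → a ∈ ｛ a ｝
  ∈｛｝⁺ {a} = proj₂ (proj₂ (pairing-axiom a a) a) (inj₁ refl)

  opaque

    insert : ∀ a c → Σ[ d ∈ V ] (∀ z → z ∈ d iff (z ≡ a ⊎ z ∈ c))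
    insert a c with q , isPair ← pairing-axiom ｛ a ｝ c with d , isUnion ← union-axiom q =
      d , λ z →
        (λ z∈d → case proj₁ (isUnion z) z∈d of λ (y , y∈q , z∈y) →
           case proj₁ (isPair y) y∈q of λ
             { (inj₁ refl) → inj₁ (∈｛｝⁻ z∈y) ; (inj₂ refl) → inj₂ z∈y }) ,
        λ { (inj₁ refl) → proj₂ (isUnion z) (_ , proj₂ (isPair _) (inj₁ refl) , ∈｛｝⁺)
          ; (inj₂ z∈c)  → proj₂ (isUnion z) (_ , proj₂ (isPair _) (inj₂ refl) , z∈c) }

    -- The set is built by at most K insertions, which is why P may be an external predicate rather
    -- than a formula of set theory.
    collect : ∀ {K} (P : Fin K → Set) (f : Fin K → V) →
              Σ[ c ∈ V ] (∀ z → z ∈ c iff (Σ[ j ∈ Fin K ] P j × z ≡ f j))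
    collect {zero}  P f = ∅ , λ z → (λ z∈∅ → contradiction z∈∅ ∉∅) , λ ()
    collect {suc K} P f with c , c-spec ← collect (P ∘ suc) (f ∘ suc) | em {P zero}
    ... | no ¬P = c , λ z →
      (λ z∈c → let j , Pj , eq = proj₁ (c-spec z) z∈c in suc j , Pj , eq) ,
      λ { (zero , P0 , _) → contradiction P0 ¬P ; (suc j , Pj , eq) → proj₂ (c-spec z) (j , Pj , eq) }
    ... | yes P0 with d , d-spec ← insert (f zero) c = d , λ z →
      (λ z∈d → case proj₁ (d-spec z) z∈d of λ
         { (inj₁ eq)  → zero , P0 , eq
         ; (inj₂ z∈c) → let j , Pj , eq = proj₁ (c-spec z) z∈c in suc j , Pj , eq }) ,
      λ { (zero , _ , eq)   → proj₂ (d-spec z) (inj₁ eq)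
        ; (suc j , Pj , eq) → proj₂ (d-spec z) (inj₂ (proj₂ (c-spec z) (j , Pj , eq))) }

  unorderedPair-unique : ∀ {p q a b} → IsUnorderedPair p a b → IsUnorderedPair q a b → p ≡ q
  unorderedPair-unique u v = extensional λ z →
    (proj₂ (v z) ∘ proj₁ (u z)) , (proj₂ (u z) ∘ proj₁ (v z))

  opaque

    orderedPair : ∀ a b → Σ[ p ∈ V ] IsOrderedPair p a b
    orderedPair a b
      with c , c-spec ← pairing-axiom a a | d , d-spec ← pairing-axiom a b
      with p , p-spec ← pairing-axiom c d =
      p , λ z →
        (λ z∈p → case proj₁ (p-spec z) z∈p of λ
           { (inj₁ refl) → inj₁ c-spec ; (inj₂ refl) → inj₂ d-spec }) ,
        λ { (inj₁ u) → proj₂ (p-spec z) (inj₁ (unorderedPair-unique u c-spec))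
          ; (inj₂ u) → proj₂ (p-spec z) (inj₂ (unorderedPair-unique u d-spec)) }

  orderedPair-first : ∀ {p a b c d} → IsOrderedPair p a b → IsOrderedPair p c d → c ≡ a
  orderedPair-first {a = a} {c = c} isab iscd with s , s-spec ← pairing-axiom a a =
    [ id , id ]′ (proj₁ (s-spec c) (case proj₁ (iscd s) (proj₂ (isab s) (inj₁ s-spec)) of λ
      { (inj₁ u) → proj₂ (u c) (inj₁ refl) ; (inj₂ u) → proj₂ (u c) (inj₁ refl) }))

  orderedPair-second : ∀ {p a b d} → IsOrderedPair p a b → IsOrderedPair p a d → d ≡ b
  orderedPair-second {a = a} {b} {d} isab isad
    with s , s-spec ← pairing-axiom a b | t , t-spec ← pairing-axiom a d =
    case proj₁ (isab t) (proj₂ (isad t) (inj₂ t-spec)) of λ where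
      (inj₂ u) → case proj₁ (u d) (proj₂ (t-spec d) (inj₂ refl)) of λ where
        (inj₂ d≡b) → d≡b
        (inj₁ d≡a) → collapsed d≡a
      (inj₁ u) → collapsed ([ id , id ]′ (proj₁ (u d) (proj₂ (t-spec d) (inj₂ refl))))
    where
    -- If d = a then p is {{a}}, so its member {a, b} is {a} and b = a as well.
    collapsed : d ≡ a → d ≡ b
    collapsed refl with s , s-spec ← pairing-axiom a b =
      case proj₁ (isad s) (proj₂ (isab s) (inj₂ s-spec)) of λ where
        (inj₁ u) → sym ([ id , id ]′ (proj₁ (u b) (proj₂ (s-spec b) (inj₂ refl))))
        (inj₂ u) → sym ([ id , id ]′ (proj₁ (u b) (proj₂ (s-spec b) (inj₂ refl))))

  -- The flat system with one equation x i = {x j : R i j} ∪ {a i} for each i, coded as a set of `𝔐`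
  -- so that AFA applies to it.
  module FlatSystems {K} (R : Fin K → Fin K → Set) (x a : Fin K → V)
                     (x-injective : ∀ {i j} → x i ≡ x j → i ≡ j)
                     (x-disjoint : ∀ {i j} → ¬ x i ≡ a j) where

    range : (Fin K → V) → V
    range f = proj₁ (collect (λ _ → ⊤) f)

    ∈range⁺ : ∀ f {i} → f i ∈ range f
    ∈range⁺ f {i} = proj₂ (proj₂ (collect (λ _ → ⊤) f) (f i)) (i , tt , refl)

    ∈range⁻ : ∀ f {z} → z ∈ range f → Σ[ i ∈ Fin K ] z ≡ f i
    ∈range⁻ f {z} z∈ =
      let i , _ , eq = proj₁ (proj₂ (collect (λ _ → ⊤) f) z) z∈ in i , eq

    t : Fin K → V
    t i = proj₁ (insert (a i) (proj₁ (collect (R i) x)))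

    ∈t : ∀ i z → z ∈ t i iff (z ≡ a i ⊎ (Σ[ j ∈ Fin K ] R i j × z ≡ x j))
    ∈t i z with c-spec ← proj₂ (collect (R i) x) | d-spec ← proj₂ (insert (a i) (proj₁ (collect (R i) x))) =
      (λ z∈ → case proj₁ (d-spec z) z∈ of λ
         { (inj₁ eq) → inj₁ eq ; (inj₂ z∈c) → inj₂ (proj₁ (c-spec z) z∈c) }) ,
      λ { (inj₁ eq) → proj₂ (d-spec z) (inj₁ eq)
        ; (inj₂ r)  → proj₂ (d-spec z) (inj₂ (proj₂ (c-spec z) r)) }

    equation : Fin K → V
    equation i = proj₁ (orderedPair (x i) (t i))

    equation-spec : ∀ i → IsOrderedPair (equation i) (x i) (t i)
    equation-spec i = proj₂ (orderedPair (x i) (t i))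

    X A S : V
    X = range x
    A = range a
    S = range equation

    S-value : ∀ i → IsValue S (x i) (t i)
    S-value i = equation i , ∈range⁺ equation , equation-spec i

    S-unique : ∀ i y → IsValue S (x i) y → y ≡ t i
    S-unique i y (p , p∈S , isPair) with j , refl ← ∈range⁻ equation p∈S
      with refl ← x-injective (orderedPair-first (equation-spec j) isPair) =
      orderedPair-second (equation-spec j) isPair

    S-function : IsFunction S X
    S-function =
      (λ p p∈S → case ∈range⁻ equation p∈S of λ
         { (i , refl) → x i , ∈range⁺ x , t i , equation-spec i }) ,
      λ y y∈X → case ∈range⁻ x y∈X of λ { (i , refl) → t i , S-value i , S-unique i }

    flat : IsFlat X A S
    flat =
      (λ z z∈X z∈A → case ∈range⁻ x z∈X of λ
         { (i , refl) → x-disjoint (proj₂ (∈range⁻ a z∈A)) }) ,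
      S-function ,
      λ y y∈X u isValue z z∈u → case ∈range⁻ x y∈X of λ where
        (i , refl) → case proj₁ (∈t i z) (subst (z ∈_) (S-unique i u isValue) z∈u) of λ where
          (inj₁ refl)           → inj₂ (∈range⁺ a)
          (inj₂ (j , _ , refl)) → inj₁ (∈range⁺ x)

    s : V
    s = proj₁ (afa X A S flat)

    solution : IsSolution X A S s
    solution = proj₂ (afa X A S flat)

    value : Fin K → V
    value i = proj₁ (proj₂ (proj₁ solution) (x i) (∈range⁺ x))

    s-value : ∀ i → IsValue s (x i) (value i)
    s-value i = proj₁ (proj₂ (proj₂ (proj₁ solution) (x i) (∈range⁺ x)))

    s-unique : ∀ i y → IsValue s (x i) y → y ≡ value i
    s-unique i = proj₂ (proj₂ (proj₂ (proj₁ solution) (x i) (∈range⁺ x)))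

    -- The defining clause of a solution, read back through the coding: `x-disjoint` ensures that
    -- members of `t i` lying in X are only the x j, and that the one lying in A is a i.
    ∈value : ∀ i z → z ∈ value i iff ((Σ[ j ∈ Fin K ] R i j × z ≡ value j) ⊎ z ≡ a i)
    ∈value i z with to , from ←
      proj₂ solution (x i) (∈range⁺ x) (t i) (value i) (S-value i , s-value i) z =
      (λ z∈ → case to z∈ of λ where
         (inj₁ (y , y∈t , y∈X , isValue)) → case proj₁ (∈t i y) y∈t of λ where
           (inj₁ refl) → contradiction (sym (proj₂ (∈range⁻ x y∈X))) x-disjoint
           (inj₂ (j , Rij , refl)) → inj₁ (j , Rij , s-unique j z isValue)
         (inj₂ (z∈t , z∈A)) → case proj₁ (∈t i z) z∈t of λ where
           (inj₁ eq) → inj₂ eq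
           (inj₂ (j , Rij , refl)) → contradiction (proj₂ (∈range⁻ a z∈A)) x-disjoint) ,
      λ { (inj₁ (j , Rij , refl)) → from (inj₁ (x j , proj₂ (∈t i (x j)) (inj₂ (j , Rij , refl)) ,
                                                ∈range⁺ x , s-value j))
        ; (inj₂ refl) → from (inj₂ (proj₂ (∈t i (a i)) (inj₁ refl) , ∈range⁺ a)) }

  -- Zermelo numerals: a supply of distinct sets, each with an externally finite descent to ∅, from
  -- which both indeterminates and atoms are taken.
  numeral : ℕ → V
  numeral zero    = ∅
  numeral (suc n) = ｛ numeral n ｝

  numeral-injective : ∀ {m n} → numeral m ≡ numeral n → m ≡ n
  numeral-injective {zero}  {zero}  eq = refl
  numeral-injective {zero}  {suc n} eq = contradiction (subst (numeral n ∈_) (sym eq) ∈｛｝⁺) ∉∅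
  numeral-injective {suc m} {zero}  eq = contradiction (subst (numeral m ∈_) eq ∈｛｝⁺) ∉∅
  numeral-injective {suc m} {suc n} eq =
    cong suc (numeral-injective (∈｛｝⁻ (subst (numeral m ∈_) eq ∈｛｝⁺)))

  -- Vertex i becomes the set of its neighbours together with an atom of its own.
  -- The atoms are well-founded, so they are neither vertices nor joined to any.
  doubleEdge-component : ∀ {K} (R : Fin K → Fin K → Set) →
    (∀ {i j} → R i j → R j i) → (∀ i → Σ[ j ∈ Fin K ] R i j) →
    Σ[ f ∈ (Fin K → V) ] (∀ {i j} → f i ≡ f j → i ≡ j) ×
      (∀ i z → (f i ∈ z × z ∈ f i) iff (Σ[ j ∈ Fin K ] R i j × z ≡ f j))
  doubleEdge-component {K} R symmetric serial = value , value-injective , λ i z →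
    (λ (v∈z , z∈v) → case proj₁ (∈value i z) z∈v of λ where
       (inj₁ r)    → r
       (inj₂ refl) → contradiction v∈z (value∉numeral (toℕ i))) ,
    λ { (j , Rij , refl) → proj₂ (∈value j (value i)) (inj₁ (i , symmetric Rij , refl)) ,
                           proj₂ (∈value i (value j)) (inj₁ (j , Rij , refl)) }
    where
    -- The atoms are the numerals below K; shifting by K keeps the indeterminates apart from them.
    open FlatSystems R (λ i → numeral (K + toℕ i)) (numeral ∘ toℕ)
      (λ eq → toℕ-injective (+-cancelˡ-≡ K _ _ (numeral-injective eq)))
      (λ {i} {j} eq → contradiction (numeral-injective eq)
         (>⇒≢ (<-≤-trans (toℕ<n j) (m≤m+n K (toℕ i)))))

    -- Infinite descent: by seriality a vertex has a vertex as a member, so a vertex equal to a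
    -- numeral forces one equal to the preceding numeral, and finally a member of ∅.
    value≢numeral : ∀ n {i} → ¬ value i ≡ numeral n
    value∉numeral : ∀ n {i} → ¬ value i ∈ numeral n

    value≢numeral n {i} eq with j , Rij ← serial i =
      value∉numeral n (subst (value j ∈_) eq (proj₂ (∈value i (value j)) (inj₁ (j , Rij , refl))))

    value∉numeral zero    v∈∅ = ∉∅ v∈∅
    value∉numeral (suc n) v∈n = value≢numeral n (∈｛｝⁻ v∈n)

    -- The atom of a vertex is the only numeral among its members, so it determines the index.
    value-injective : ∀ {i j} → value i ≡ value j → i ≡ j
    value-injective {i} {j} eq =
      case proj₁ (∈value j _) (subst (numeral (toℕ i) ∈_) eq
             (proj₂ (∈value i _) (inj₂ refl))) of λ where
        (inj₁ (_ , _ , n≡v)) → contradiction (sym n≡v) (value≢numeral (toℕ i))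
        (inj₂ n≡n)           → toℕ-injective (numeral-injective n≡n)

-- Walks of double edges on a looped path

graphRelCode : GraphRel ↣ ℕ
graphRelCode = mk↣ {to = λ { E → 0 ; D → 1 }}
  λ { {E} {E} _ → refl ; {D} {D} _ → refl }

-- u is the vertex visited before v, to which the walk must not return at once;
-- a walk starts with u = v.
walk : ∀ {m} → ℕ → Fin m → Fin m → Formula 𝓛-graph m
walk zero    u v = rel D (v ∷ v ∷ [])
walk (suc n) u v =
  ∃′ (¬′ (0F ≐ suc u) ∧′ ¬′ (0F ≐ suc v) ∧′ rel D (suc v ∷ 0F ∷ []) ∧′ walk n (suc v) 0F)

module LoopedPath (em : ExcludedMiddle 0ℓ) (𝔐 : Structure 𝓛-set) (zfa : 𝔐 ⊨ᵗ ZFA)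
                  (S : ℕ → Set) (k : ℕ) where

  open SetTheory em 𝔐 zfa

  -- The vertices are 0, ..., k + 1. Loops are read off at 0, ..., k; the extra vertex gives vertex
  -- 0 a neighbour even when k = 0, as `adjacent-serial` requires.
  K : ℕ
  K = 2 + k

  Adjacent : Fin K → Fin K → Set
  Adjacent i j = toℕ j ≡ suc (toℕ i) ⊎ toℕ i ≡ suc (toℕ j) ⊎ (i ≡ j × S (toℕ i))

  adjacent-sym : ∀ {i j} → Adjacent i j → Adjacent j i
  adjacent-sym (inj₁ eq)                 = inj₂ (inj₁ eq)
  adjacent-sym (inj₂ (inj₁ eq))          = inj₁ eq
  adjacent-sym (inj₂ (inj₂ (refl , Si))) = inj₂ (inj₂ (refl , Si))

  adjacent-serial : ∀ i → Σ[ j ∈ Fin K ] Adjacent i j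
  adjacent-serial zero    = 1F , inj₁ refl
  adjacent-serial (suc i) = inject₁ i , inj₂ (inj₁ (cong suc (sym (toℕ-inject₁ i))))

  component = doubleEdge-component Adjacent adjacent-sym adjacent-serial

  vertex : Fin K → V
  vertex = proj₁ component

  vertex-injective : ∀ {i j} → vertex i ≡ vertex j → i ≡ j
  vertex-injective = proj₁ (proj₂ component)

  doubleEdge : ∀ i z → (vertex i ∈ z × z ∈ vertex i) iff (Σ[ j ∈ Fin K ] Adjacent i j × z ≡ vertex j)
  doubleEdge = proj₂ (proj₂ component)

  -- Induction on n, with the walk at vertex i after coming from i - 1. The double-edge neighbours
  -- of i are i + 1, i - 1 and, at a loop, i itself; the inequalities with `u` and `v` exclude the
  -- last two. Since `pred 0` is 0, the start `u` = `v` at vertex 0 fits the same invariant.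
  walk-spec : ∀ n {m} (ρ : Vec V m) u v h i →
    lookup ρ u ≡ vertex h → lookup ρ v ≡ vertex i → toℕ h ≡ pred (toℕ i) → toℕ i + n < K →
    (membershipGraph 𝔐 , ρ ⊨′ walk n u v) iff S (toℕ i + n)
  walk-spec zero ρ u v h i u≡ v≡ h≡ i+n<K rewrite v≡ | +-identityʳ (toℕ i) =
    (λ loop → case proj₁ (doubleEdge i (vertex i)) loop of λ where
      (j , i~j , eq) → looped (subst (Adjacent i) (vertex-injective (sym eq)) i~j)) ,
    λ Si → proj₂ (doubleEdge i (vertex i)) (i , inj₂ (inj₂ (refl , Si)) , refl)
    where
    looped : Adjacent i i → S (toℕ i)
    looped (inj₁ eq)              = contradiction (sym eq) 1+n≢n
    looped (inj₂ (inj₁ eq))       = contradiction (sym eq) 1+n≢n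
    looped (inj₂ (inj₂ (_ , Si))) = Si
  walk-spec (suc n) {m} ρ u v h i u≡ v≡ h≡ i+n<K = forth , back
    where
    next<K : suc (toℕ i) < K
    next<K = ≤-<-trans (m≤m+n (suc (toℕ i)) n) (subst (_< K) (+-suc (toℕ i) n) i+n<K)

    next : Fin K
    next = fromℕ< next<K

    next≡ : toℕ next ≡ suc (toℕ i)
    next≡ = toℕ-fromℕ< next<K

    next+n : toℕ next + n ≡ toℕ i + suc n
    next+n = trans (cong (_+ n) next≡) (sym (+-suc (toℕ i) n))

    continue : ∀ {w} → w ≡ vertex next →
      (membershipGraph 𝔐 , w ∷ ρ ⊨′ walk n (suc v) 0F) iff S (toℕ i + suc n)
    continue {w} w≡ = subst (λ l → (membershipGraph 𝔐 , w ∷ ρ ⊨′ walk n (suc v) 0F) iff S l) next+n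
      (walk-spec n (w ∷ ρ) (suc v) 0F i next v≡ w≡ (cong pred (sym next≡))
        (subst (_< K) (sym next+n) i+n<K))

    forth : membershipGraph 𝔐 , ρ ⊨′ walk (suc n) u v → S (toℕ i + suc n)
    forth (w , w≢u , w≢v , edge , rest)
      with proj₁ (doubleEdge i w) (subst (λ x → x ∈ w × w ∈ x) v≡ edge)
    ... | j , inj₁ j≡ , w≡ =
      proj₁ (continue (trans w≡ (cong vertex (toℕ-injective (trans j≡ (sym next≡)))))) rest
    ... | j , inj₂ (inj₁ i≡) , w≡ = contradiction
      (trans w≡ (trans (cong vertex (toℕ-injective (trans (cong pred (sym i≡)) (sym h≡)))) (sym u≡))) w≢u
    ... | j , inj₂ (inj₂ (refl , _)) , w≡ = contradiction (trans w≡ (sym v≡)) w≢v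

    back : S (toℕ i + suc n) → membershipGraph 𝔐 , ρ ⊨′ walk (suc n) u v
    back s = vertex next , next≢ u≡ (≤-trans (≤-reflexive h≡) pred[n]≤n) , next≢ v≡ ≤-refl ,
      subst (λ x → x ∈ vertex next × vertex next ∈ x) (sym v≡)
        (proj₂ (doubleEdge i (vertex next)) (next , inj₁ next≡ , refl)) ,
      proj₂ (continue refl) s
      where
      -- Both the previous and the current vertex have index at most i, while the next one has index
      -- i + 1.
      next≢ : ∀ {x l} → lookup ρ x ≡ vertex l → toℕ l ≤ toℕ i → ¬ vertex next ≡ lookup ρ x
      next≢ x≡ l≤i eq = contradiction
        (trans (cong toℕ (sym (vertex-injective (trans eq x≡)))) next≡)
        (<⇒≢ (s≤s l≤i))

theorem3 : ExcludedMiddle 0ℓ →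
    (𝔐 : Structure 𝓛-set) → Countable 𝔐 → 𝔐 ⊨ᵗ ZFA →
    ¬ ℵ₀-Categorical (membershipGraph 𝔐)
theorem3 em 𝔐 countable zfa =
  independent⇒¬ℵ₀-categorical graphRelCode (membershipGraph 𝔐) countable (λ n → walk n 0F 0F)
    λ S k → let open LoopedPath em 𝔐 zfa S k in
      vertex 0F , λ n n≤k →
        let to , from = walk-spec n (vertex 0F ∷ []) 0F 0F 0F 0F refl refl refl
                          (s≤s (m≤n⇒m≤1+n n≤k))
        in mk⇔ to from
  where open Classical em
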